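{- There exists $N_0$ such that the following holds. Let $q\ge1$ and $r$ be integers with $1\le r\le 0.6q$ and let $n=q^2+q+1+r\ge N_0$ (so $n\in\{q^2+q+2,\dots,(q+1)^2\}$). Then $$\mathrm{ex}(n,C_4)=\mathrm{ex}(q^2+q+1+r,C_4)\le \frac12\big(q^2+q+1+\max\{r,\,2r-0.3q\}\big)(q+1).$$
   Context: $\mathrm{ex}(n,C_4)$ denotes the maximum number of edges in an $n$-vertex simple graph containing no cycle of length four as a subgraph. -}

module Defs where

open import Data.Nat using (ℕ; _<ᵇ_)
open import Data.Bool using (Bool; true; false; _∧_; if_then_else_)
open import Data.Fin using (Fin; toℕ)
open import Data.List using (List; map; allFin)
open import Data.Nat.ListAction using (sum)
open import Data.Product using (∃-syntax; _×_)
open import Relation.Binary.PropositionalEquality using (_≡_; _≢_)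
open import Relation.Nullary using (¬_)

record SimpleGraph (n : ℕ) : Set where
  field
    adj   : Fin n → Fin n → Bool
    sym   : ∀ i j → adj i j ≡ adj j i
    loopless : ∀ i → adj i i ≡ false

open SimpleGraph public

_∼[_]_ : ∀ {n} → Fin n → SimpleGraph n → Fin n → Set
i ∼[ G ] j = adj G i j ≡ true

edgeCount : ∀ {n} → SimpleGraph n → ℕ
edgeCount {n} G =
  sum (map (λ i → sum (map (λ j →
         if (toℕ i <ᵇ toℕ j) ∧ adj G i j then 1 else 0) (allFin n))) (allFin n))

HasC4 : ∀ {n} → SimpleGraph n → Set
HasC4 {n} G = ∃[ a ] ∃[ b ] ∃[ c ] ∃[ d ]
  ( a ≢ b × a ≢ c × a ≢ d × b ≢ c × b ≢ d × c ≢ d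
  × a ∼[ G ] b × b ∼[ G ] c × c ∼[ G ] d × d ∼[ G ] a )

C4Free : ∀ {n} → SimpleGraph n → Set
C4Free G = ¬ HasC4 G

-- Write n = q² + q + 1 + r, m = q + 1, d(v) = m + x(v) and X = Σ x.  Since 2e = n m + X, a
-- counterexample has X > 0 and 10 X ≥ (10 r - 3 q) m.
--
-- For a set T let f(w) be the number of neighbours of w in T.  As distinct vertices have at
-- most one common neighbour, Σ f² ≤ |T|² + Σ_T (d - 1), and counting the paths
-- of length two from T gives Σ x f ≤ r |T| - q Σ_T x.
--
-- Take T = {x ≥ 1} and P = Σ_T x.  Then f is close to its mean: g = m f - |T| has
-- Σ g² ≤ m³ P, while the assumption on X turns the second estimate into
-- Σ (- x) g ≥ 0.7 m q P.  The vertices with x > 0 contribute little to this sum: for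
-- x ≤ q / 1600 by AM-GM, and the larger ones have total excess at most m² / 40, by the
-- same two estimates applied to them.  For the vertices with y = - x ≥ 0, adding
-- 4 m y g ≤ 4 m² y (m - y), which is f ≤ d, to 4 m y g ≤ 4 m² y² + g² yields
-- 8 m Σ y g ≤ 4 m³ Σ y + Σ g² ≤ 5 m³ P, a contradiction because 5/8 < 0.7.
module Submission where

open import Defs

module Counting where

  open import Data.Bool using (Bool; true; false; _∧_; if_then_else_)
  open import Data.Empty using (⊥)
  open import Data.Fin as Fin using (Fin; zero; suc; toℕ)
  open import Data.Fin.Properties using (toℕ-injective; suc-injective)
  open import Data.Integer
    using (ℤ; +_; -[1+_]; _+_; _*_; -_; _-_; _≤_; _<_; 0ℤ; 1ℤ; +≤+; +<+; positive; nonNegative)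
  open import Data.Integer.Properties
  open import Data.Integer.Tactic.RingSolver using (solve-∀)
  open import Data.List as List using (allFin)
  import Data.List.Properties as List
  open import Data.Nat as ℕ using (ℕ; zero; suc; s≤s; z≤n; _<ᵇ_)
  import Data.Nat.ListAction as ListAction
  import Data.Nat.Properties as ℕ
  import Data.Nat.Tactic.RingSolver as ℕRing
  open import Data.Product using (_×_; _,_; proj₁; proj₂)
  open import Function using (_∘_)
  open import Relation.Binary.PropositionalEquality renaming (sym to ≡-sym)
  open import Relation.Nullary using (Dec; yes; no; does; contradiction)
  open import Relation.Nullary.Decidable using (toWitness)
  open import Algebra.Properties.Semiring.Sum +-*-semiring

  -- Certified inequalities between integers.

  infixl 6 _⊕_
  infixl 7 _⊗_

  -- A polynomial inequality a ≤ b is certified by writing b - a as a nonnegative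
  -- combination of the gaps of the hypotheses; the ring solver checks the identity.
  ≤-by : ∀ {a b e} → 0ℤ ≤ e → b - a ≡ e → a ≤ b
  ≤-by 0≤e eq = 0≤i-j⇒j≤i (subst (0ℤ ≤_) (≡-sym eq) 0≤e)

  _⊕_ : ∀ {a b} → 0ℤ ≤ a → 0ℤ ≤ b → 0ℤ ≤ a + b
  _⊕_ = +-mono-≤

  _⊗_ : ∀ {a b} → 0ℤ ≤ a → 0ℤ ≤ b → 0ℤ ≤ a * b
  _⊗_ {+ m} {+ n} _ _ = subst (0ℤ ≤_) (pos-* m n) (+≤+ z≤n)

  gap : ∀ {a b} → a ≤ b → 0ℤ ≤ b - a
  gap = i≤j⇒0≤j-i

  0≤+ : ∀ n → 0ℤ ≤ + n
  0≤+ n = +≤+ z≤n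

  0≤a² : ∀ a → 0ℤ ≤ a * a
  0≤a² (+ n) = 0≤+ n ⊗ 0≤+ n
  0≤a² -[1+ n ] = +≤+ z≤n

  -- Finite sums and indicator weights.

  sum-mono : ∀ {n} {f g : Fin n → ℤ} → (∀ i → f i ≤ g i) → sum f ≤ sum g
  sum-mono {zero}  f≤g = ≤-refl
  sum-mono {suc n} f≤g = +-mono-≤ (f≤g zero) (sum-mono (f≤g ∘ suc))

  sum-const : ∀ n {c} → ∑[ i < n ] c ≡ + n * c
  sum-const zero    {c} = ≡-sym (*-zeroˡ c)
  sum-const (suc n) {c} = trans (cong (λ s → c + s) (sum-const n)) (≡-sym (suc-* (+ n) c))

  sum-nonneg : ∀ {n} {f : Fin n → ℤ} → (∀ i → 0ℤ ≤ f i) → 0ℤ ≤ sum f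
  sum-nonneg {n} {f} 0≤f = subst (_≤ sum f) (trans (sum-const n) (*-zeroʳ (+ n))) (sum-mono 0≤f)

  sum-linear : ∀ {n} c e (f g : Fin n → ℤ) →
               ∑[ i < n ] (c * f i + e * g i) ≡ c * sum f + e * sum g
  sum-linear c e f g = trans (∑-distrib-+ (λ i → c * f i) (λ i → e * g i))
    (≡-sym (cong₂ _+_ (*-distribˡ-sum c f) (*-distribˡ-sum e g)))

  χ : ∀ {p} {P : Set p} → Dec P → ℤ
  χ d = if does d then 1ℤ else 0ℤ

  χ-idem : ∀ {p} {P : Set p} (d : Dec P) → χ d * χ d ≡ χ d
  χ-idem (yes _) = refl
  χ-idem (no  _) = refl

  δ : ∀ {n} → Fin n → Fin n → ℤ
  δ i j = χ (i Fin.≟ j)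

  sum-δ : ∀ {n} (i : Fin n) (f : Fin n → ℤ) → ∑[ j < n ] (δ i j * f j) ≡ f i
  sum-δ {suc n} zero f = trans (cong₂ _+_ (*-identityˡ (f zero)) (sum-cong-≗ (λ j → *-zeroˡ (f (suc j)))))
    (trans (cong (λ s → f zero + s) (trans (sum-const n) (*-zeroʳ (+ n)))) (+-identityʳ _))
  sum-δ {suc n} (suc i) f = trans (cong₂ _+_ (*-zeroˡ (f zero)) (sum-δ i (f ∘ suc))) (+-identityˡ _)

  -- Vertex sets are encoded as weights with `t² = t`. Being a square bounds `t` below; in the next
  -- lemma `1 - t = (1 - t)²` bounds it above.
  idem⇒0≤ : ∀ {n} {t : Fin n → ℤ} → (∀ i → t i * t i ≡ t i) → ∀ i → 0ℤ ≤ t i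
  idem⇒0≤ {t = t} idem i = subst (0ℤ ≤_) (idem i) (0≤a² (t i))

  idem⇒≤1 : ∀ {n} {t : Fin n → ℤ} → (∀ i → t i * t i ≡ t i) → ∀ i → t i ≤ 1ℤ
  idem⇒≤1 {t = t} idem i = ≤-by (0≤a² (1ℤ - t i))
    (trans (double (t i)) (trans (cong (λ s → 1ℤ - t i - t i + s) (≡-sym (idem i))) (square (t i))))
    where
    double : ∀ t → 1ℤ - t ≡ 1ℤ - t - t + t
    double = solve-∀
    square : ∀ t → 1ℤ - t - t + t * t ≡ (1ℤ - t) * (1ℤ - t)
    square = solve-∀

  sum-linear₃ : ∀ {n} c e k (f g h : Fin n → ℤ) →
                ∑[ i < n ] (c * f i + e * g i + k * h i) ≡ c * sum f + e * sum g + k * sum h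
  sum-linear₃ c e k f g h = trans (∑-distrib-+ (λ i → c * f i + e * g i) (λ i → k * h i))
    (cong₂ _+_ (sum-linear c e f g) (≡-sym (*-distribˡ-sum k h)))

  sum-linear₄ : ∀ {n} c e k l (f g h u : Fin n → ℤ) →
                ∑[ i < n ] (c * f i + e * g i + k * h i + l * u i) ≡ c * sum f + e * sum g + k * sum h + l * sum u
  sum-linear₄ c e k l f g h u = trans (∑-distrib-+ (λ i → c * f i + e * g i + k * h i) (λ i → l * u i))
    (cong₂ _+_ (sum-linear₃ c e k f g h) (≡-sym (*-distribˡ-sum l u)))

  sum-scale-mono : ∀ {n} c e {f g : Fin n → ℤ} → (∀ i → c * f i ≤ e * g i) → c * sum f ≤ e * sum g
  sum-scale-mono c e {f} {g} h =
    subst₂ _≤_ (≡-sym (*-distribˡ-sum c f)) (≡-sym (*-distribˡ-sum e g)) (sum-mono h)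

  cancel-≤ : ∀ c {a b} → 0ℤ < c → c * a ≤ c * b → a ≤ b
  cancel-≤ c 0<c = *-cancelˡ-≤-pos _ _ c {{positive 0<c}}

  pos-product : ∀ {a b} → 0ℤ < a → 0ℤ < b → 0ℤ < a * b
  pos-product {a} {b} 0<a 0<b = subst (_< a * b) (*-zeroʳ a) (*-monoˡ-<-pos a {{positive 0<a}} 0<b)

  1≤⇒0< : ∀ {a} → 1ℤ ≤ a → 0ℤ < a
  1≤⇒0< = <-≤-trans (+<+ (s≤s z≤n))

  -- Polynomial inequalities between the global quantities.

  -- The hypotheses give `5 r n ≤ 3 q (q + 1)²`, and `5 q³ - 3 q (q + 1)² = q (2 q² - 6 q - 3)`,
  -- whose quadratic factor is positive from 4 on.
  n*r≤q³ : ∀ q r n → + 4 ≤ q → 0ℤ ≤ n → + 5 * r ≤ + 3 * q → n ≤ (q + 1ℤ) * (q + 1ℤ) →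
           r * n ≤ q * q * q
  n*r≤q³ q r n 4≤q 0≤n 5r≤3q n≤m² = cancel-≤ (+ 5) (+<+ (s≤s z≤n))
    (≤-by (0≤n ⊗ gap 5r≤3q ⊕ 0≤+ 3 ⊗ 0≤q ⊗ gap n≤m²
           ⊕ 0≤q ⊗ (0≤+ 2 ⊗ 0≤q ⊗ gap 4≤q ⊕ 0≤+ 2 ⊗ gap 4≤q ⊕ 0≤+ 5))
      (certificate q r n))
    where
    0≤q : 0ℤ ≤ q
    0≤q = ≤-trans (0≤+ 4) 4≤q
    certificate : ∀ q r n → + 5 * (q * q * q) - + 5 * (r * n)
      ≡ n * (+ 3 * q - + 5 * r) + + 3 * q * ((q + 1ℤ) * (q + 1ℤ) - n)
        + q * (+ 2 * q * (q - + 4) + + 2 * (q - + 4) + + 5)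
    certificate = solve-∀

  -- Here and in the next lemma B is the set of vertices with L x > q, b = |B|,
  -- Y = Σ_B x, S = Σ x², and with f w the number of neighbours of w in B,
  -- F = Σ f x and G = Σ f².
  few-large : ∀ L q r n b Y S → 0ℤ ≤ L → 1ℤ ≤ q → 0ℤ ≤ b → 0ℤ ≤ Y →
    0ℤ ≤ r * n → r * n ≤ q * q * q →
    q * b ≤ L * Y → q * q * b ≤ L * L * S → S ≤ r * n → b * b ≤ L * L * L * Y
  few-large L q r n b Y S 0≤L 1≤q 0≤b 0≤Y 0≤rn rn≤q³ qb≤Y q²b≤S S≤rn =
    -- Multiply `q b ≤ L Y` by `q² b ≤ L² S ≤ L² r n ≤ L² q³`.
    cancel-≤ (q * q * q) (pos-product (pos-product 0<q 0<q) 0<q)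
      (≤-by (0≤L ⊗ 0≤L ⊗ 0≤L ⊗ 0≤Y ⊗ gap rn≤q³ ⊕ 0≤L ⊗ 0≤L ⊗ 0≤rn ⊗ gap qb≤Y
             ⊕ 0≤q ⊗ 0≤b ⊗ (0≤L ⊗ 0≤L ⊗ gap S≤rn ⊕ gap q²b≤S))
        (certificate L q r n b Y S))
    where
    0<q : 0ℤ < q
    0<q = 1≤⇒0< 1≤q
    0≤q : 0ℤ ≤ q
    0≤q = <⇒≤ 0<q
    certificate : ∀ L q r n b Y S → q * q * q * (L * L * L * Y) - q * q * q * (b * b)
      ≡ L * L * L * Y * (q * q * q - r * n) + L * L * (r * n) * (L * Y - q * b)
        + q * b * (L * L * (r * n - S) + (L * L * S - q * q * b))
    certificate = solve-∀

  -- 0 ≤ S + 80F + 1600G is AM-GM, as the right-hand side is Σ (x + 40f)².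
  large-excess-small : ∀ K L q r n b Y S F G → 0ℤ ≤ K → 0ℤ ≤ L →
    + 1600 * (K + L + 1ℤ) ≤ q → 0ℤ ≤ n → 0ℤ ≤ b → 0ℤ ≤ Y →
    + 5 * r ≤ + 3 * q → n ≤ (q + 1ℤ) * (q + 1ℤ) →
    b * b ≤ K * Y → q * b ≤ L * Y → b ≤ Y → S ≤ r * n →
    F ≤ r * b - q * Y → G ≤ b * b + (Y + q * b) → 0ℤ ≤ S + + 80 * F + + 1600 * G →
    + 40 * Y ≤ (q + 1ℤ) * (q + 1ℤ)
  large-excess-small K L q r n b Y S F G 0≤K 0≤L Q≤q 0≤n 0≤b 0≤Y 5r≤3q n≤m² b²≤Y qb≤Y b≤Y S≤rn F≤ G≤ 0≤SFG =
    cancel-≤ (+ 3) (+<+ (s≤s z≤n))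
      (≤-by (gap 155Y≤3m² ⊕ 0≤+ 35 ⊗ 0≤Y) (certificate₃ q Y))
    where
    0<q : 0ℤ < q
    0<q = <-≤-trans (*-monoˡ-<-pos (+ 1600) (+-mono-≤-< (0≤K ⊕ 0≤L) (+<+ (s≤s z≤n)))) Q≤q
    0≤q : 0ℤ ≤ q
    0≤q = <⇒≤ 0<q
    certificate₁ : ∀ K L q r n b Y S F G → r * n - + 31 * q * Y
      ≡ (S + + 80 * F + + 1600 * G) + + 80 * (r * b - q * Y - F)
        + + 1600 * (b * b + (Y + q * b) - G) + (r * n - S)
        + + 1600 * (K * Y - b * b) + + 1600 * (L * Y - q * b)
        + + 16 * b * (+ 3 * q - + 5 * r) + + 48 * q * (Y - b)
        + Y * (q - + 1600 * (K + L + 1ℤ))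
    certificate₁ = solve-∀
    -- Here `80 F ≤ 48 q b - 80 q Y ≤ - 32 q Y`, because `5 r ≤ 3 q` and `b ≤ Y`, while
    -- `1600 G ≤ 1600 (K + L + 1) Y ≤ q Y` gives back only one `q Y`.
    31qY≤rn : + 31 * q * Y ≤ r * n
    31qY≤rn = ≤-by (0≤SFG ⊕ 0≤+ 80 ⊗ gap F≤ ⊕ 0≤+ 1600 ⊗ gap G≤ ⊕ gap S≤rn
      ⊕ 0≤+ 1600 ⊗ gap b²≤Y ⊕ 0≤+ 1600 ⊗ gap qb≤Y ⊕ 0≤+ 16 ⊗ 0≤b ⊗ gap 5r≤3q
      ⊕ 0≤+ 48 ⊗ 0≤q ⊗ gap b≤Y ⊕ 0≤Y ⊗ gap Q≤q)
      (certificate₁ K L q r n b Y S F G)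
    certificate₂ : ∀ q r n Y → q * (+ 3 * ((q + 1ℤ) * (q + 1ℤ))) - q * (+ 155 * Y)
      ≡ + 5 * (r * n - + 31 * q * Y) + n * (+ 3 * q - + 5 * r)
        + + 3 * q * ((q + 1ℤ) * (q + 1ℤ) - n)
    certificate₂ = solve-∀
    -- `155 q Y ≤ 5 r n ≤ 3 q n`; since `155 = 3 * 40 + 35`, this is stronger than the factor 40 of
    -- the conclusion.
    155Y≤3m² : + 155 * Y ≤ + 3 * ((q + 1ℤ) * (q + 1ℤ))
    155Y≤3m² = cancel-≤ q 0<q
      (≤-by (0≤+ 5 ⊗ gap 31qY≤rn ⊕ 0≤n ⊗ gap 5r≤3q ⊕ 0≤+ 3 ⊗ 0≤q ⊗ gap n≤m²)
        (certificate₂ q r n Y))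
    certificate₃ : ∀ q Y → + 3 * ((q + 1ℤ) * (q + 1ℤ)) - + 3 * (+ 40 * Y)
      ≡ (+ 3 * ((q + 1ℤ) * (q + 1ℤ)) - + 155 * Y) + + 35 * Y
    certificate₃ = solve-∀

  -- With f w the number of neighbours of w in T, p = |T| and P = Σ_T x, the
  -- left-hand side is Σ (m f - p)² after inserting Σ f = P + m p and G = Σ f².
  variance-bound : ∀ m n p P G → 0ℤ ≤ m → 0ℤ ≤ m - 1ℤ → 0ℤ ≤ p → p ≤ P → n ≤ m * m →
    G ≤ p * p + (P + (m - 1ℤ) * p) →
    m * m * G + (- (+ 2 * m * p)) * (P + m * p) + p * p * n ≤ m * m * m * P
  variance-bound m n p P G 0≤m 0≤q 0≤p p≤P n≤m² G≤ =
    -- The terms `m² p²` cancel, with coefficients 1, -2 and, through `n ≤ m²`, 1 again. What is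
    -- left is at most `m² P + m² (m - 1) p ≤ m³ P`.
    ≤-by (0≤m ⊗ 0≤m ⊗ gap G≤ ⊕ 0≤p ⊗ 0≤p ⊗ gap n≤m² ⊕ 0≤m ⊗ 0≤m ⊗ 0≤q ⊗ gap p≤P
          ⊕ 0≤+ 2 ⊗ 0≤m ⊗ 0≤p ⊗ (0≤p ⊕ gap p≤P))
      (certificate m n p P G)
    where
    certificate : ∀ m n p P G →
      m * m * m * P - (m * m * G + (- (+ 2 * m * p)) * (P + m * p) + p * p * n)
      ≡ m * m * (p * p + (P + (m - 1ℤ) * p) - G) + p * p * (m * m - n)
        + m * m * (m - 1ℤ) * (P - p) + + 2 * m * p * (p + (P - p))
    certificate = solve-∀

  -- Notation of the previous lemma, except F = Σ f x and G = Σ (m f - p)² with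
  -- m = q + 1; moreover X = Σ x, and Y is the excess of the vertices with L x > q.
  correlation-absurd : ∀ q r p P X Y F G → + 27 ≤ q → 0ℤ ≤ p → p ≤ P → 0ℤ < P → 0ℤ ≤ X →
    (+ 10 * r - + 3 * q) * (q + 1ℤ) ≤ + 10 * X →
    + 40 * Y ≤ (q + 1ℤ) * (q + 1ℤ) →
    F ≤ r * p - q * P → G ≤ (q + 1ℤ) * (q + 1ℤ) * (q + 1ℤ) * P →
    + 80 * (q + 1ℤ) * (p * X - (q + 1ℤ) * F)
      ≤ + 40 * ((q + 1ℤ) * (q + 1ℤ) * (q + 1ℤ)) * (P - X) + + 11 * G
        + (q + 1ℤ) * (q + 1ℤ) * q * P + + 80 * (q + 1ℤ) * p * Y →
    ⊥
  correlation-absurd q r p P X Y F G 27≤q 0≤p p≤P 0<P 0≤X X≥ Y≤ F≤ G≤ key =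
    <⇒≱ (+-mono-<-≤ (+<+ {n = 10} (s≤s z≤n)) (0≤+ 20 ⊗ gap 27≤q)) (cancel-≤ _ 0<m²P bound)
    where
    0≤q : 0ℤ ≤ q
    0≤q = ≤-trans (0≤+ 27) 27≤q
    0<m : 0ℤ < q + 1ℤ
    0<m = 1≤⇒0< (+-mono-≤ 0≤q (≤-refl {1ℤ}))
    0≤m : 0ℤ ≤ q + 1ℤ
    0≤m = <⇒≤ 0<m
    0<m²P : 0ℤ < (q + 1ℤ) * (q + 1ℤ) * P
    0<m²P = pos-product (pos-product 0<m 0<m) 0<P
    certificate : ∀ q r p P X Y F G →
      (q + 1ℤ) * (q + 1ℤ) * P * 0ℤ - (q + 1ℤ) * (q + 1ℤ) * P * (+ 10 + + 20 * (q - + 27))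
      ≡ + 10 * (+ 40 * ((q + 1ℤ) * (q + 1ℤ) * (q + 1ℤ)) * (P - X) + + 11 * G
                + (q + 1ℤ) * (q + 1ℤ) * q * P + + 80 * (q + 1ℤ) * p * Y
                - + 80 * (q + 1ℤ) * (p * X - (q + 1ℤ) * F))
        + + 80 * (q + 1ℤ) * (+ 10 * (q + 1ℤ) * (r * p - q * P - F)
                + + 3 * (q + 1ℤ) * q * (P - p) + p * (+ 10 * X - (+ 10 * r - + 3 * q) * (q + 1ℤ)))
        + + 110 * ((q + 1ℤ) * (q + 1ℤ) * (q + 1ℤ) * P - G)
        + + 20 * (q + 1ℤ) * p * ((q + 1ℤ) * (q + 1ℤ) - + 40 * Y)
        + + 20 * (q + 1ℤ) * (q + 1ℤ) * (q + 1ℤ) * (P - p)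
        + + 400 * (q + 1ℤ) * (q + 1ℤ) * (q + 1ℤ) * X
    certificate = solve-∀
    -- With `m = q + 1`, the left side of `key` is at least `80 m * 0.7 m q P = 56 m² q P` and the
    -- right side at most `(40 + 11 + 2) m³ P + m² q P`. Hence `56 q ≤ 53 (q + 1) + q`, or
    -- `2 q ≤ 53`, which fails from 27 on; `bound` is ten times this.
    bound : (q + 1ℤ) * (q + 1ℤ) * P * (+ 10 + + 20 * (q - + 27)) ≤ (q + 1ℤ) * (q + 1ℤ) * P * 0ℤ
    bound = ≤-by (0≤+ 10 ⊗ gap key
        ⊕ 0≤+ 80 ⊗ 0≤m ⊗ (0≤+ 10 ⊗ 0≤m ⊗ gap F≤ ⊕ 0≤+ 3 ⊗ 0≤m ⊗ 0≤q ⊗ gap p≤P ⊕ 0≤p ⊗ gap X≥)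
        ⊕ 0≤+ 110 ⊗ gap G≤ ⊕ 0≤+ 20 ⊗ 0≤m ⊗ 0≤p ⊗ gap Y≤
        ⊕ 0≤+ 20 ⊗ 0≤m ⊗ 0≤m ⊗ 0≤m ⊗ gap p≤P ⊕ 0≤+ 400 ⊗ 0≤m ⊗ 0≤m ⊗ 0≤m ⊗ 0≤X)
      (certificate q r p P X Y F G)

  -- Estimates at a single vertex.

  x≤χx : ∀ {x} (pos? : Dec (1ℤ ≤ x)) → x ≤ χ pos? * x
  x≤χx {x} (yes _)  = ≤-reflexive (≡-sym (*-identityˡ x))
  x≤χx {x} (no 1≰x) = subst (x ≤_) (≡-sym (*-zeroˡ x)) (i<j⇒i≤pred[j] (≰⇒> 1≰x))

  χ≤χx : ∀ {x} (pos? : Dec (1ℤ ≤ x)) → χ pos? ≤ χ pos? * x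
  χ≤χx {x} (yes 1≤x) = subst (1ℤ ≤_) (≡-sym (*-identityˡ x)) 1≤x
  χ≤χx {x} (no _)    = ≤-reflexive (≡-sym (*-zeroˡ x))

  -- L is eventually 1600, but it stays a variable: a product of unknowns with
  -- a closed 1600² or 1600³ would be unfolded in unary.
  large⇒positive : ∀ {L q x} → 0ℤ ≤ L → 0ℤ ≤ q → q < L * x → 1ℤ ≤ x
  large⇒positive {L} {q} {x} 0≤L 0≤q q<Lx = i<j⇒suc[i]≤j {i = 0ℤ}
    (*-cancelˡ-<-nonNeg {i = 0ℤ} {j = x} L {{nonNegative 0≤L}}
      (subst (_< L * x) (≡-sym (*-zeroʳ L)) (≤-<-trans 0≤q q<Lx)))

  module _ {L q x : ℤ} (0≤L : 0ℤ ≤ L) (0≤q : 0ℤ ≤ q) where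

    large⇒1≤ : (d : Dec (q < L * x)) → χ d ≤ χ d * x
    large⇒1≤ (yes q<Lx) = subst (1ℤ ≤_) (≡-sym (*-identityˡ x)) (large⇒positive 0≤L 0≤q q<Lx)
    large⇒1≤ (no _)     = ≤-reflexive (≡-sym (*-zeroˡ x))

    large⇒q≤ : (d : Dec (q < L * x)) → q * χ d ≤ L * (χ d * x)
    large⇒q≤ (yes q<Lx) = ≤-by (gap (<⇒≤ q<Lx)) (units L q x)
      where
      units : ∀ L q x → L * (1ℤ * x) - q * 1ℤ ≡ L * x - q
      units = solve-∀
    large⇒q≤ (no _) = ≤-reflexive (zeros L q x)
      where
      zeros : ∀ L q x → q * 0ℤ ≡ L * (0ℤ * x)
      zeros = solve-∀

    -- Summed over the vertices this is Chebyshev's inequality for the number of large ones. Away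
    -- from them the right side is a square, so the whole of `Σ x²` may stand there.
    large⇒q²≤ : (d : Dec (q < L * x)) → q * q * χ d ≤ L * L * (x * x)
    large⇒q²≤ (yes q<Lx) = ≤-by ((0≤q ⊕ 0≤q ⊕ gap (<⇒≤ q<Lx)) ⊗ gap (<⇒≤ q<Lx)) (squares L q x)
      where
      squares : ∀ L q x → L * L * (x * x) - q * q * 1ℤ
                  ≡ (q + q + (L * x - q)) * (L * x - q)
      squares = solve-∀
    large⇒q²≤ (no _) = ≤-by (0≤a² (L * x)) (squares L q x)
      where
      squares : ∀ L q x → L * L * (x * x) - q * q * 0ℤ ≡ L * x * (L * x)
      squares = solve-∀

    -- The summand 80 m (- x) g of the correlation of - x with g = m f - p.
    -- For large x use g ≥ - p, for other positive x use
    -- - 80 m x g ≤ 1600 m² x² + g² ≤ m² q x + g², and for y = - x ≥ 0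
    -- one half each of g ≤ m (m - y) and of 4 m y g ≤ 4 m² y² + g².
    weighted-deviation : ∀ {m f p} → + 1600 ≤ L → 0ℤ ≤ m → 0ℤ ≤ p → 0ℤ ≤ f → f ≤ x + m →
      (pos? : Dec (1ℤ ≤ x)) (large? : Dec (q < L * x)) →
      + 80 * m * p * x + (- (+ 80 * m * m)) * (f * x)
        ≤ (+ 40 * m * m * m + m * m * q) * (χ pos? * x) + (- (+ 40 * m * m * m)) * x
          + + 11 * ((m * f - p) * (m * f - p)) + + 80 * m * p * (χ large? * x)
    weighted-deviation {m} {f} {p} 1600≤L 0≤m 0≤p 0≤f f≤d (yes 1≤x) (yes _) =
      ≤-by (0≤m ⊗ 0≤m ⊗ 0≤q ⊗ 0≤x ⊕ 0≤+ 11 ⊗ 0≤a² (m * f - p) ⊕ 0≤+ 80 ⊗ 0≤m ⊗ 0≤x ⊗ (0≤m ⊗ 0≤f))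
        (certificate m q f p x)
      where
      0≤x : 0ℤ ≤ x
      0≤x = ≤-trans (0≤+ 1) 1≤x
      certificate : ∀ m q f p x →
        (+ 40 * m * m * m + m * m * q) * (1ℤ * x) + (- (+ 40 * m * m * m)) * x
          + + 11 * ((m * f - p) * (m * f - p)) + + 80 * m * p * (1ℤ * x)
          - (+ 80 * m * p * x + (- (+ 80 * m * m)) * (f * x))
        ≡ m * m * q * x + + 11 * ((m * f - p) * (m * f - p)) + + 80 * m * x * (m * f)
      certificate = solve-∀
    weighted-deviation {m} {f} {p} 1600≤L 0≤m 0≤p 0≤f f≤d (yes 1≤x) (no Lx≰q) =
      ≤-by (0≤m ⊗ 0≤m ⊗ 0≤x ⊗ gap (≮⇒≥ Lx≰q) ⊕ 0≤m ⊗ 0≤m ⊗ 0≤x ⊗ 0≤x ⊗ gap 1600≤L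
            ⊕ 0≤a² (+ 40 * m * x + (m * f - p)) ⊕ 0≤+ 10 ⊗ 0≤a² (m * f - p))
        (certificate L m q f p x)
      where
      0≤x : 0ℤ ≤ x
      0≤x = ≤-trans (0≤+ 1) 1≤x
      certificate : ∀ L m q f p x →
        (+ 40 * m * m * m + m * m * q) * (1ℤ * x) + (- (+ 40 * m * m * m)) * x
          + + 11 * ((m * f - p) * (m * f - p)) + + 80 * m * p * (0ℤ * x)
          - (+ 80 * m * p * x + (- (+ 80 * m * m)) * (f * x))
        ≡ m * m * x * (q - L * x) + m * m * x * x * (L - + 1600)
          + (+ 40 * m * x + (m * f - p)) * (+ 40 * m * x + (m * f - p))
          + + 10 * ((m * f - p) * (m * f - p))
      certificate = solve-∀
    weighted-deviation 1600≤L 0≤m 0≤p 0≤f f≤d (no 1≰x) (yes q<Lx) =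
      contradiction (large⇒positive 0≤L 0≤q q<Lx) 1≰x
    weighted-deviation {m} {f} {p} 1600≤L 0≤m 0≤p 0≤f f≤d (no 1≰x) (no _) =
      ≤-by (0≤+ 10 ⊗ 0≤a² (+ 2 * m * x + (m * f - p)) ⊕ 0≤a² (m * f - p)
            ⊕ 0≤+ 40 ⊗ 0≤m ⊗ gap x≤0 ⊗ (0≤m ⊗ gap f≤d ⊕ 0≤p))
        (certificate m q f p x)
      where
      x≤0 : x ≤ 0ℤ
      x≤0 = i<j⇒i≤pred[j] (≰⇒> 1≰x)
      certificate : ∀ m q f p x →
        (+ 40 * m * m * m + m * m * q) * (0ℤ * x) + (- (+ 40 * m * m * m)) * x
          + + 11 * ((m * f - p) * (m * f - p)) + + 80 * m * p * (0ℤ * x)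
          - (+ 80 * m * p * x + (- (+ 80 * m * m)) * (f * x))
        ≡ + 10 * ((+ 2 * m * x + (m * f - p)) * (+ 2 * m * x + (m * f - p))) + (m * f - p) * (m * f - p)
          + + 40 * m * (0ℤ - x) * (m * (x + m - f) + p)
      certificate = solve-∀

  -- The adjacency operator of a weighted graph.

  module WeightedGraph {n} (a : Fin n → Fin n → ℤ)
    (a-sym : ∀ i j → a i j ≡ a j i)
    (0≤a : ∀ i j → 0ℤ ≤ a i j) where

    infixr 8 A_
    A_ : (Fin n → ℤ) → Fin n → ℤ
    (A t) i = ∑[ j < n ] (a i j * t j)

    deg : Fin n → ℤ
    deg = A (λ _ → 1ℤ)

    codeg : Fin n → Fin n → ℤ
    codeg i j = ∑[ k < n ] (a i k * a k j)

    A-self-adjoint : ∀ s t → ∑[ i < n ] (s i * (A t) i) ≡ ∑[ i < n ] ((A s) i * t i)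
    A-self-adjoint s t = begin
      ∑[ i < n ] (s i * (A t) i)
        ≡⟨ sum-cong-≗ (λ i → *-distribˡ-sum (s i) (λ j → a i j * t j)) ⟩
      ∑[ i < n ] ∑[ j < n ] (s i * (a i j * t j))
        ≡⟨ ∑-comm (λ i j → s i * (a i j * t j)) ⟩
      ∑[ j < n ] ∑[ i < n ] (s i * (a i j * t j))
        ≡⟨ sum-cong-≗ (λ j → sum-cong-≗ (λ i → trans (regroup (s i) (a i j) (t j))
             (cong (λ b → b * s i * t j) (a-sym i j)))) ⟩
      ∑[ j < n ] ∑[ i < n ] (a j i * s i * t j)
        ≡⟨ sum-cong-≗ (λ j → *-distribʳ-sum (t j) (λ i → a j i * s i)) ⟨
      ∑[ j < n ] ((A s) j * t j) ∎
      where
      open ≡-Reasoning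
      regroup : ∀ s a t → s * (a * t) ≡ a * s * t
      regroup = solve-∀

    A²≡codeg : ∀ t i → (A (A t)) i ≡ ∑[ j < n ] (codeg i j * t j)
    A²≡codeg t i = begin
      ∑[ k < n ] (a i k * (A t) k)
        ≡⟨ sum-cong-≗ (λ k → *-distribˡ-sum (a i k) (λ j → a k j * t j)) ⟩
      ∑[ k < n ] ∑[ j < n ] (a i k * (a k j * t j))
        ≡⟨ ∑-comm (λ k j → a i k * (a k j * t j)) ⟩
      ∑[ j < n ] ∑[ k < n ] (a i k * (a k j * t j))
        ≡⟨ sum-cong-≗ (λ j → sum-cong-≗ (λ k → *-assoc (a i k) (a k j) (t j))) ⟨
      ∑[ j < n ] ∑[ k < n ] (a i k * a k j * t j)
        ≡⟨ sum-cong-≗ (λ j → *-distribʳ-sum (t j) (λ k → a i k * a k j)) ⟨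
      ∑[ j < n ] (codeg i j * t j) ∎
      where open ≡-Reasoning

    A-nonneg : ∀ {t} → (∀ i → 0ℤ ≤ t i) → ∀ i → 0ℤ ≤ (A t) i
    A-nonneg 0≤t i = sum-nonneg (λ j → 0≤a i j ⊗ 0≤t j)

    A≤deg : ∀ {t} → (∀ i → t i ≤ 1ℤ) → ∀ i → (A t) i ≤ deg i
    A≤deg t≤1 i = sum-mono λ j → ≤-by (0≤a i j ⊗ gap (t≤1 j)) (factor (a i j) _)
      where
      factor : ∀ a t → a * 1ℤ - a * t ≡ a * (1ℤ - t)
      factor = solve-∀

    -- C₄-freeness bounds the codegree by 1 off the diagonal; on it, codegree is degree.
    module _ (codeg≤ : ∀ i j → codeg i j ≤ 1ℤ + δ i j * (deg i - 1ℤ)) where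

      -- Moving one `A` across gives `Σ s (A² t)`. The entries of `A²` are the codegrees, so `A²` is
      -- entrywise at most the all-ones matrix plus the diagonal matrix of `deg - 1`; nonnegative
      -- weights preserve this comparison.
      A-bilinear≤ : ∀ {s t} → (∀ i → 0ℤ ≤ s i) → (∀ i → 0ℤ ≤ t i) →
        ∑[ i < n ] ((A s) i * (A t) i) ≤ sum s * sum t + ∑[ i < n ] (s i * t i * (deg i - 1ℤ))
      A-bilinear≤ {s} {t} 0≤s 0≤t = begin
        ∑[ i < n ] ((A s) i * (A t) i)
          ≡⟨ A-self-adjoint s (A t) ⟨
        ∑[ i < n ] (s i * (A (A t)) i)
          ≤⟨ sum-mono row ⟩
        ∑[ i < n ] (s i * sum t + s i * t i * (deg i - 1ℤ))
          ≡⟨ ∑-distrib-+ (λ i → s i * sum t) (λ i → s i * t i * (deg i - 1ℤ)) ⟩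
        ∑[ i < n ] (s i * sum t) + ∑[ i < n ] (s i * t i * (deg i - 1ℤ))
          ≡⟨ cong (_+ ∑[ i < n ] (s i * t i * (deg i - 1ℤ))) (*-distribʳ-sum (sum t) s) ⟨
        sum s * sum t + ∑[ i < n ] (s i * t i * (deg i - 1ℤ)) ∎
        where
        open ≤-Reasoning
        A²≤ : ∀ i → (A (A t)) i ≤ sum t + (deg i - 1ℤ) * t i
        A²≤ i = begin
          (A (A t)) i
            ≡⟨ A²≡codeg t i ⟩
          ∑[ j < n ] (codeg i j * t j)
            ≤⟨ sum-mono (λ j → ≤-by (gap (codeg≤ i j) ⊗ 0≤t j) (expand (codeg i j) (δ i j) (deg i) (t j))) ⟩
          ∑[ j < n ] (1ℤ * t j + (deg i - 1ℤ) * (δ i j * t j))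
            ≡⟨ sum-linear 1ℤ (deg i - 1ℤ) t (λ j → δ i j * t j) ⟩
          1ℤ * sum t + (deg i - 1ℤ) * ∑[ j < n ] (δ i j * t j)
            ≡⟨ cong₂ _+_ (*-identityˡ (sum t)) (cong ((deg i - 1ℤ) *_) (sum-δ i t)) ⟩
          sum t + (deg i - 1ℤ) * t i ∎
          where
          expand : ∀ c e d t → 1ℤ * t + (d - 1ℤ) * (e * t) - c * t ≡ (1ℤ + e * (d - 1ℤ) - c) * t
          expand = solve-∀
        row : ∀ i → s i * (A (A t)) i ≤ s i * sum t + s i * t i * (deg i - 1ℤ)
        row i = ≤-by (0≤s i ⊗ gap (A²≤ i)) (expand (s i) (sum t) (t i) (deg i) ((A (A t)) i))
          where
          expand : ∀ s T t d y → s * T + s * t * (d - 1ℤ) - s * y ≡ s * (T + (d - 1ℤ) * t - y)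
          expand = solve-∀

      -- Degree excesses at order `q² + q + 1 + r`.

      module _ (q r : ℤ) (n≡ : + n ≡ q * q + q + 1ℤ + r) where

        x : Fin n → ℤ
        x i = deg i - (q + 1ℤ)

        excess : (Fin n → ℤ) → ℤ
        excess t = ∑[ i < n ] (t i * x i)

        sum-deg : ∀ t → ∑[ i < n ] (t i * deg i) ≡ excess t + (q + 1ℤ) * sum t
        sum-deg t = begin
          ∑[ i < n ] (t i * deg i)
            ≡⟨ sum-cong-≗ (λ i → split (t i) (deg i) q) ⟩
          ∑[ i < n ] (1ℤ * (t i * x i) + (q + 1ℤ) * t i)
            ≡⟨ sum-linear 1ℤ (q + 1ℤ) (λ i → t i * x i) t ⟩
          1ℤ * excess t + (q + 1ℤ) * sum t
            ≡⟨ cong (_+ (q + 1ℤ) * sum t) (*-identityˡ (excess t)) ⟩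
          excess t + (q + 1ℤ) * sum t ∎
          where
          open ≡-Reasoning
          split : ∀ t d q → t * d ≡ 1ℤ * (t * (d - (q + 1ℤ))) + (q + 1ℤ) * t
          split = solve-∀

        sum-A : ∀ t → sum (A t) ≡ excess t + (q + 1ℤ) * sum t
        sum-A t = begin
          ∑[ i < n ] ((A t) i)         ≡⟨ sum-cong-≗ (λ i → *-identityˡ ((A t) i)) ⟨
          ∑[ i < n ] (1ℤ * (A t) i)    ≡⟨ A-self-adjoint (λ _ → 1ℤ) t ⟩
          ∑[ i < n ] (deg i * t i)     ≡⟨ sum-cong-≗ (λ i → *-comm (deg i) (t i)) ⟩
          ∑[ i < n ] (t i * deg i)     ≡⟨ sum-deg t ⟩
          excess t + (q + 1ℤ) * sum t  ∎
          where open ≡-Reasoning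

        sum-deg-1 : ∀ t → ∑[ i < n ] (t i * (deg i - 1ℤ)) ≡ excess t + q * sum t
        sum-deg-1 t = begin
          ∑[ i < n ] (t i * (deg i - 1ℤ))
            ≡⟨ sum-cong-≗ (λ i → split (t i) (deg i) q) ⟩
          ∑[ i < n ] (1ℤ * (t i * x i) + q * t i)
            ≡⟨ sum-linear 1ℤ q (λ i → t i * x i) t ⟩
          1ℤ * excess t + q * sum t
            ≡⟨ cong (_+ q * sum t) (*-identityˡ (excess t)) ⟩
          excess t + q * sum t ∎
          where
          open ≡-Reasoning
          split : ∀ t d q → t * (d - 1ℤ) ≡ 1ℤ * (t * (d - (q + 1ℤ))) + q * t
          split = solve-∀

        -- Use `A-bilinear≤` against the constant weight 1, whose image is `deg`, and subtract
        -- `(q + 1) Σ A t`. The coefficient of `sum t` becomes `n + q - (q + 1)² = r`, that of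
        -- `excess t` becomes `1 - (q + 1) = - q`.
        sum-A*x≤ : ∀ {t} → (∀ i → 0ℤ ≤ t i) →
          ∑[ i < n ] ((A t) i * x i) ≤ r * sum t - q * excess t
        sum-A*x≤ {t} 0≤t = begin
          ∑[ i < n ] ((A t) i * x i)
            ≡⟨ sum-cong-≗ (λ i → split ((A t) i) (deg i) q) ⟩
          ∑[ i < n ] (1ℤ * ((A t) i * deg i) + (- (q + 1ℤ)) * (A t) i)
            ≡⟨ sum-linear 1ℤ (- (q + 1ℤ)) (λ i → (A t) i * deg i) (A t) ⟩
          1ℤ * ∑[ i < n ] ((A t) i * deg i) + (- (q + 1ℤ)) * sum (A t)
            ≤⟨ +-monoˡ-≤ ((- (q + 1ℤ)) * sum (A t)) (*-monoˡ-≤-nonNeg 1ℤ (A-bilinear≤ 0≤t (λ _ → 0≤+ 1))) ⟩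
          1ℤ * (sum t * ∑[ i < n ] 1ℤ + ∑[ i < n ] (t i * 1ℤ * (deg i - 1ℤ))) + (- (q + 1ℤ)) * sum (A t)
            ≡⟨ cong₂ (λ c e → 1ℤ * (sum t * c + e) + (- (q + 1ℤ)) * sum (A t))
                 (trans (sum-const n) (cong (_* 1ℤ) n≡))
                 (trans (sum-cong-≗ (λ i → cong (_* (deg i - 1ℤ)) (*-identityʳ (t i)))) (sum-deg-1 t)) ⟩
          1ℤ * (sum t * ((q * q + q + 1ℤ + r) * 1ℤ) + (excess t + q * sum t)) + (- (q + 1ℤ)) * sum (A t)
            ≡⟨ cong (λ e → 1ℤ * (sum t * ((q * q + q + 1ℤ + r) * 1ℤ) + (excess t + q * sum t)) + (- (q + 1ℤ)) * e) (sum-A t) ⟩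
          1ℤ * (sum t * ((q * q + q + 1ℤ + r) * 1ℤ) + (excess t + q * sum t))
            + (- (q + 1ℤ)) * (excess t + (q + 1ℤ) * sum t)
            ≡⟨ collect q r (sum t) (excess t) ⟩
          r * sum t - q * excess t ∎
          where
          open ≤-Reasoning
          split : ∀ f d q → f * (d - (q + 1ℤ)) ≡ 1ℤ * (f * d) + (- (q + 1ℤ)) * f
          split = solve-∀
          collect : ∀ q r T X →
            1ℤ * (T * ((q * q + q + 1ℤ + r) * 1ℤ) + (X + q * T)) + (- (q + 1ℤ)) * (X + (q + 1ℤ) * T)
            ≡ r * T - q * X
          collect = solve-∀

        sum-A²≤ : ∀ {t} → (∀ i → t i * t i ≡ t i) →
          ∑[ i < n ] ((A t) i * (A t) i) ≤ sum t * sum t + (excess t + q * sum t)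
        sum-A²≤ {t} idem = ≤-trans (A-bilinear≤ (idem⇒0≤ idem) (idem⇒0≤ idem))
          (≤-reflexive (cong (λ s → sum t * sum t + s)
            (trans (sum-cong-≗ (λ i → cong (_* (deg i - 1ℤ)) (idem i))) (sum-deg-1 t))))

        -- Write `x² = deg x - (q + 1) x` and take the weight 1 in `sum-A*x≤`. The bound is
        -- `r n - (2 q + 1) Σ x`, and `Σ x ≥ 0`.
        sum-x²≤ : 0ℤ ≤ q → 0ℤ ≤ sum x → ∑[ i < n ] (x i * x i) ≤ r * + n
        sum-x²≤ 0≤q 0≤X = begin
          ∑[ i < n ] (x i * x i)
            ≡⟨ sum-cong-≗ (λ i → split (deg i) q) ⟩
          ∑[ i < n ] (1ℤ * (deg i * x i) + (- (q + 1ℤ)) * x i)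
            ≡⟨ sum-linear 1ℤ (- (q + 1ℤ)) (λ i → deg i * x i) x ⟩
          1ℤ * ∑[ i < n ] (deg i * x i) + (- (q + 1ℤ)) * sum x
            ≤⟨ +-monoˡ-≤ ((- (q + 1ℤ)) * sum x) (*-monoˡ-≤-nonNeg 1ℤ (sum-A*x≤ (λ _ → 0≤+ 1))) ⟩
          1ℤ * (r * ∑[ i < n ] 1ℤ - q * ∑[ i < n ] (1ℤ * x i)) + (- (q + 1ℤ)) * sum x
            ≡⟨ cong₂ (λ c e → 1ℤ * (r * c - q * e) + (- (q + 1ℤ)) * sum x)
                 (sum-const n) (sum-cong-≗ (λ i → *-identityˡ (x i))) ⟩
          1ℤ * (r * (+ n * 1ℤ) - q * sum x) + (- (q + 1ℤ)) * sum x
            ≤⟨ ≤-by ((0≤q ⊕ 0≤q ⊕ 0≤+ 1) ⊗ 0≤X) (collect (+ n) r q (sum x)) ⟩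
          r * + n ∎
          where
          open ≤-Reasoning
          split : ∀ d q → (d - (q + 1ℤ)) * (d - (q + 1ℤ)) ≡ 1ℤ * (d * (d - (q + 1ℤ))) + (- (q + 1ℤ)) * (d - (q + 1ℤ))
          split = solve-∀
          collect : ∀ n r q X → r * n - (1ℤ * (r * (n * 1ℤ) - q * X) + (- (q + 1ℤ)) * X) ≡ (q + q + 1ℤ) * X
          collect = solve-∀

        -- The contradiction for large `q`.

        module _ (L : ℤ) (1600≤L : + 1600 ≤ L) (Q≤q : + 1600 * (L * L * L + L + 1ℤ) ≤ q)
                 (0≤r : 0ℤ ≤ r) (5r≤3q : + 5 * r ≤ + 3 * q) (0≤X : 0ℤ ≤ sum x) where

          0≤L : 0ℤ ≤ L
          0≤L = ≤-trans (0≤+ 1600) 1600≤L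

          0≤L³ : 0ℤ ≤ L * L * L
          0≤L³ = 0≤L ⊗ 0≤L ⊗ 0≤L

          1600≤q : + 1600 ≤ q
          1600≤q = ≤-trans (*-monoˡ-≤-nonNeg (+ 1600) (+-monoˡ-≤ 1ℤ (0≤L³ ⊕ 0≤L))) Q≤q

          0≤q : 0ℤ ≤ q
          0≤q = ≤-trans (0≤+ 1600) 1600≤q

          0≤m : 0ℤ ≤ q + 1ℤ
          0≤m = 0≤q ⊕ 0≤+ 1

          n≤m² : + n ≤ (q + 1ℤ) * (q + 1ℤ)
          n≤m² = subst (_≤ (q + 1ℤ) * (q + 1ℤ)) (≡-sym n≡)
            (cancel-≤ (+ 5) (+<+ (s≤s z≤n)) (≤-by (gap 5r≤3q ⊕ 0≤+ 2 ⊗ 0≤q) (certificate q r)))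
            where
            certificate : ∀ q r → + 5 * ((q + 1ℤ) * (q + 1ℤ)) - + 5 * (q * q + q + 1ℤ + r)
                          ≡ (+ 3 * q - + 5 * r) + + 2 * q
            certificate = solve-∀

          large? : ∀ i → Dec (q < L * x i)
          large? i = q <? L * x i

          large : Fin n → ℤ
          large i = χ (large? i)

          large-idem : ∀ i → large i * large i ≡ large i
          large-idem i = χ-idem (large? i)

          -- `few-large` supplies `K = L³` for `large-excess-small`; the threshold `Q≤q` is chosen
          -- to absorb the resulting bound on `1600 Σ f²`.
          large-excess≤ : + 40 * excess large ≤ (q + 1ℤ) * (q + 1ℤ)
          large-excess≤ = large-excess-small (L * L * L) L q r (+ n) b Y S
              (∑[ i < n ] ((A large) i * x i)) (∑[ i < n ] ((A large) i * (A large) i))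
              0≤L³ 0≤L Q≤q (0≤+ n) 0≤b 0≤Y 5r≤3q n≤m²
              (few-large L q r (+ n) b Y S 0≤L (≤-trans (+≤+ (s≤s z≤n)) 1600≤q) 0≤b 0≤Y
                (0≤r ⊗ 0≤+ n) (n*r≤q³ q r (+ n) (≤-trans (+≤+ (toWitness {a? = 4 ℕ.≤? 1600} _)) 1600≤q) (0≤+ n) 5r≤3q n≤m²)
                qb≤Y q²b≤S S≤rn)
              qb≤Y b≤Y S≤rn
              (sum-A*x≤ (idem⇒0≤ large-idem)) (sum-A²≤ large-idem) 0≤SFG
            where
            b Y S : ℤ
            b = sum large
            Y = excess large
            S = ∑[ i < n ] (x i * x i)
            0≤b : 0ℤ ≤ b
            0≤b = sum-nonneg (idem⇒0≤ large-idem)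
            b≤Y : b ≤ Y
            b≤Y = sum-mono (λ i → large⇒1≤ 0≤L 0≤q (large? i))
            0≤Y : 0ℤ ≤ Y
            0≤Y = ≤-trans 0≤b b≤Y
            qb≤Y : q * b ≤ L * Y
            qb≤Y = sum-scale-mono q L (λ i → large⇒q≤ 0≤L 0≤q (large? i))
            q²b≤S : q * q * b ≤ L * L * S
            q²b≤S = sum-scale-mono (q * q) (L * L) (λ i → large⇒q²≤ 0≤L 0≤q (large? i))
            S≤rn : S ≤ r * + n
            S≤rn = sum-x²≤ 0≤q 0≤X
            0≤SFG : 0ℤ ≤ S + + 80 * ∑[ i < n ] ((A large) i * x i) + + 1600 * ∑[ i < n ] ((A large) i * (A large) i)
            0≤SFG = subst (0ℤ ≤_)
              (trans (sum-cong-≗ (λ i → expand ((A large) i) (x i)))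
                (trans (sum-linear₃ 1ℤ (+ 80) (+ 1600) (λ i → x i * x i) (λ i → (A large) i * x i) (λ i → (A large) i * (A large) i))
                  (cong (λ s → s + + 80 * ∑[ i < n ] ((A large) i * x i) + + 1600 * ∑[ i < n ] ((A large) i * (A large) i))
                    (*-identityˡ S))))
              (sum-nonneg (λ i → 0≤a² (x i + + 40 * (A large) i)))
              where
              expand : ∀ f x → (x + + 40 * f) * (x + + 40 * f) ≡ 1ℤ * (x * x) + + 80 * (f * x) + + 1600 * (f * f)
              expand = solve-∀

          positive? : ∀ i → Dec (1ℤ ≤ x i)
          positive? i = 1ℤ ≤? x i

          pos : Fin n → ℤ
          pos i = χ (positive? i)

          pos-idem : ∀ i → pos i * pos i ≡ pos i
          pos-idem i = χ-idem (positive? i)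

          -- The squared deviation of `A pos` from `sum pos / (q + 1)`, which would be its mean if
          -- all degrees were `q + 1` and `n = (q + 1)²`; the factor `(q + 1)²` keeps it integral.
          deviation² : ℤ
          deviation² = ∑[ i < n ] (((q + 1ℤ) * (A pos) i - sum pos) * ((q + 1ℤ) * (A pos) i - sum pos))

          0≤pos : 0ℤ ≤ sum pos
          0≤pos = sum-nonneg (idem⇒0≤ pos-idem)

          pos≤excess : sum pos ≤ excess pos
          pos≤excess = sum-mono (λ i → χ≤χx (positive? i))

          deviation²≤ : deviation² ≤ (q + 1ℤ) * (q + 1ℤ) * (q + 1ℤ) * excess pos
          deviation²≤ = begin
            deviation²
              ≡⟨ sum-cong-≗ (λ i → expand (q + 1ℤ) ((A pos) i) p) ⟩
            ∑[ i < n ] (m * m * ((A pos) i * (A pos) i) + (- (+ 2 * m * p)) * (A pos) i + p * p * 1ℤ)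
              ≡⟨ sum-linear₃ (m * m) (- (+ 2 * m * p)) (p * p) (λ i → (A pos) i * (A pos) i) (A pos) (λ _ → 1ℤ) ⟩
            m * m * G + (- (+ 2 * m * p)) * sum (A pos) + p * p * ∑[ i < n ] 1ℤ
              ≡⟨ cong₂ (λ s c → m * m * G + (- (+ 2 * m * p)) * s + p * p * c)
                   (sum-A pos) (trans (sum-const n) (*-identityʳ (+ n))) ⟩
            m * m * G + (- (+ 2 * m * p)) * (excess pos + m * p) + p * p * + n
              ≤⟨ variance-bound m (+ n) p (excess pos) G 0≤m (subst (0ℤ ≤_) (≡-sym m-1≡q) 0≤q) 0≤pos pos≤excess n≤m²
                   (subst (λ k → G ≤ p * p + (excess pos + k * p)) (≡-sym m-1≡q) (sum-A²≤ pos-idem)) ⟩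
            m * m * m * excess pos ∎
            where
            open ≤-Reasoning
            m p G : ℤ
            m = q + 1ℤ
            p = sum pos
            G = ∑[ i < n ] ((A pos) i * (A pos) i)
            m-1≡q : m - 1ℤ ≡ q
            m-1≡q = cancel q
              where
              cancel : ∀ q → q + 1ℤ - 1ℤ ≡ q
              cancel = solve-∀
            expand : ∀ m f p → (m * f - p) * (m * f - p) ≡ m * m * (f * f) + (- (+ 2 * m * p)) * f + p * p * 1ℤ
            expand = solve-∀

          -- With `g = m f - p`, the difference `p X - m F` is `Σ (- x) g`, so this is
          -- `weighted-deviation` summed over all vertices. `P - X` is the total deficit of the
          -- vertices with `x ≤ 0`.
          correlation≤ :
            + 80 * (q + 1ℤ) * (sum pos * sum x - (q + 1ℤ) * ∑[ i < n ] ((A pos) i * x i))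
              ≤ + 40 * ((q + 1ℤ) * (q + 1ℤ) * (q + 1ℤ)) * (excess pos - sum x) + + 11 * deviation²
                + (q + 1ℤ) * (q + 1ℤ) * q * excess pos + + 80 * (q + 1ℤ) * sum pos * excess large
          correlation≤ = begin
            + 80 * m * (p * sum x - m * F)
              ≡⟨ regroupˡ m p (sum x) F ⟩
            + 80 * m * p * sum x + (- (+ 80 * m * m)) * F
              ≡⟨ sum-linear (+ 80 * m * p) (- (+ 80 * m * m)) x (λ i → (A pos) i * x i) ⟨
            ∑[ i < n ] (+ 80 * m * p * x i + (- (+ 80 * m * m)) * ((A pos) i * x i))
              ≤⟨ sum-mono (λ i → weighted-deviation 0≤L 0≤q 1600≤L 0≤m 0≤pos (A-nonneg (idem⇒0≤ pos-idem) i)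
                   (≤-trans (A≤deg (idem⇒≤1 pos-idem) i) (≤-reflexive (restore (deg i) q)))
                   (positive? i) (large? i)) ⟩
            ∑[ i < n ] ((+ 40 * m * m * m + m * m * q) * (pos i * x i) + (- (+ 40 * m * m * m)) * x i
              + + 11 * ((m * (A pos) i - p) * (m * (A pos) i - p)) + + 80 * m * p * (large i * x i))
              ≡⟨ sum-linear₄ (+ 40 * m * m * m + m * m * q) (- (+ 40 * m * m * m)) (+ 11) (+ 80 * m * p)
                   (λ i → pos i * x i) x (λ i → (m * (A pos) i - p) * (m * (A pos) i - p)) (λ i → large i * x i) ⟩
            (+ 40 * m * m * m + m * m * q) * excess pos + (- (+ 40 * m * m * m)) * sum x
              + + 11 * deviation² + + 80 * m * p * excess large
              ≡⟨ regroupʳ m q p (excess pos) (sum x) deviation² (excess large) ⟩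
            + 40 * (m * m * m) * (excess pos - sum x) + + 11 * deviation²
              + m * m * q * excess pos + + 80 * m * p * excess large ∎
            where
            open ≤-Reasoning
            m p F : ℤ
            m = q + 1ℤ
            p = sum pos
            F = ∑[ i < n ] ((A pos) i * x i)
            restore : ∀ d q → d ≡ d - (q + 1ℤ) + (q + 1ℤ)
            restore = solve-∀
            regroupˡ : ∀ m p X F → + 80 * m * (p * X - m * F) ≡ + 80 * m * p * X + (- (+ 80 * m * m)) * F
            regroupˡ = solve-∀
            regroupʳ : ∀ m q p P X G Y →
              (+ 40 * m * m * m + m * m * q) * P + (- (+ 40 * m * m * m)) * X + + 11 * G + + 80 * m * p * Y
              ≡ + 40 * (m * m * m) * (P - X) + + 11 * G + m * m * q * P + + 80 * m * p * Y
            regroupʳ = solve-∀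

          no-large-excess : 0ℤ < sum x → (+ 10 * r - + 3 * q) * (q + 1ℤ) ≤ + 10 * sum x → ⊥
          no-large-excess 0<X X≥ = correlation-absurd q r (sum pos) (excess pos) (sum x) (excess large)
            (∑[ i < n ] ((A pos) i * x i)) deviation²
            (≤-trans (+≤+ (toWitness {a? = 27 ℕ.≤? 1600} _)) 1600≤q) 0≤pos pos≤excess
            (<-≤-trans 0<X (sum-mono (λ i → x≤χx (positive? i)))) 0≤X X≥ large-excess≤
            (sum-A*x≤ (idem⇒0≤ pos-idem)) deviation²≤ correlation≤

  -- Simple graphs as 0/1 weights.

  ι : Bool → ℤ
  ι b = + (if b then 1 else 0)

  ι-∧ : ∀ b c → ι b * ι c ≡ ι (b ∧ c)
  ι-∧ true  true  = refl
  ι-∧ true  false = refl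
  ι-∧ false true  = refl
  ι-∧ false false = refl

  sum-ι≤1 : ∀ {n} (f : Fin n → Bool) → (∀ i j → f i ≡ true → f j ≡ true → i ≡ j) →
            ∑[ i < n ] ι (f i) ≤ 1ℤ
  sum-ι≤1 {zero}  f unique = 0≤+ 1
  sum-ι≤1 {suc n} f unique with f zero in f0
  ... | false = subst (_≤ 1ℤ) (≡-sym (+-identityˡ (∑[ i < n ] ι (f (suc i)))))
                  (sum-ι≤1 (f ∘ suc) (λ i j fi fj → suc-injective (unique (suc i) (suc j) fi fj)))
  ... | true  = ≤-reflexive (cong (λ s → 1ℤ + s) (trans (sum-cong-≗ rest) (trans (sum-const n) (*-zeroʳ (+ n)))))
    where
    rest : ∀ i → ι (f (suc i)) ≡ 0ℤ
    rest i with f (suc i) in fi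
    ... | false = refl
    ... | true  = contradiction (unique zero (suc i) f0 fi) λ ()

  sum-allFin : ∀ {n} (f : Fin n → ℕ) → + ListAction.sum (List.map f (allFin n)) ≡ ∑[ i < n ] (+ f i)
  sum-allFin {n} f = trans (cong (λ l → + ListAction.sum l) (List.map-tabulate (λ i → i) f)) (sum-tabulate f)
    where
    sum-tabulate : ∀ {n} (f : Fin n → ℕ) → + ListAction.sum (List.tabulate f) ≡ ∑[ i < n ] (+ f i)
    sum-tabulate {zero}  f = refl
    sum-tabulate {suc n} f = cong (λ s → + f zero + s) (sum-tabulate (f ∘ suc))

  -- `edgeCount` sees an edge only from its smaller end. Off the diagonal exactly one of the two
  -- comparisons holds, and on it `b` is false.
  orient : ∀ m n b → (m ≡ n → b ≡ false) → ι ((m <ᵇ n) ∧ b) + ι ((n <ᵇ m) ∧ b) ≡ ι b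
  orient zero    zero    b irrefl = cong ι (≡-sym (irrefl refl))
  orient zero    (suc n) b irrefl = +-identityʳ (ι b)
  orient (suc m) zero    b irrefl = +-identityˡ (ι b)
  orient (suc m) (suc n) b irrefl = orient m n b (irrefl ∘ cong suc)

  ∧-true : ∀ {b c} → b ∧ c ≡ true → b ≡ true × c ≡ true
  ∧-true {true} {true} _ = refl , refl

  module _ {n} (G : SimpleGraph n) where

    a : Fin n → Fin n → ℤ
    a i j = ι (adj G i j)

    a-sym : ∀ i j → a i j ≡ a j i
    a-sym i j = cong ι (sym G i j)

    0≤a : ∀ i j → 0ℤ ≤ a i j
    0≤a i j = 0≤+ _

    open WeightedGraph a a-sym 0≤a using (deg; codeg)

    ∼⇒≢ : ∀ {i j} → i ∼[ G ] j → i ≢ j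
    ∼⇒≢ {i} i∼j refl with () ← trans (≡-sym i∼j) (loopless G i)

    ∼-sym : ∀ {i j} → i ∼[ G ] j → j ∼[ G ] i
    ∼-sym {i} {j} i∼j = trans (sym G j i) i∼j

    -- Two different common neighbours `k` and `l` would close the 4-cycle `i k j l`.
    common-neighbour-unique : C4Free G → ∀ {i j} → i ≢ j → ∀ k l →
      adj G i k ∧ adj G k j ≡ true → adj G i l ∧ adj G l j ≡ true → k ≡ l
    common-neighbour-unique c4-free {i} {j} i≢j k l ikj ilj with k Fin.≟ l
    ... | yes k≡l = k≡l
    ... | no  k≢l = contradiction
      ( i , k , j , l
      , ∼⇒≢ i∼k , i≢j , ∼⇒≢ i∼l , ∼⇒≢ k∼j , k≢l , ∼⇒≢ (∼-sym l∼j)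
      , i∼k , k∼j , ∼-sym l∼j , ∼-sym i∼l) c4-free
      where
      i∼k = proj₁ (∧-true ikj)
      k∼j = proj₂ (∧-true ikj)
      i∼l = proj₁ (∧-true ilj)
      l∼j = proj₂ (∧-true ilj)

    codeg≤ : C4Free G → ∀ i j → codeg i j ≤ 1ℤ + δ i j * (deg i - 1ℤ)
    codeg≤ c4-free i j with i Fin.≟ j
    ... | yes refl = ≤-reflexive (trans (sum-cong-≗ walk) (restore (deg i)))
      where
      walk : ∀ k → a i k * a k i ≡ a i k * 1ℤ
      walk k rewrite sym G k i with adj G i k
      ... | true  = refl
      ... | false = refl
      restore : ∀ d → d ≡ 1ℤ + 1ℤ * (d - 1ℤ)
      restore = solve-∀
    ... | no i≢j = begin
      ∑[ k < n ] (a i k * a k j)            ≡⟨ sum-cong-≗ (λ k → ι-∧ (adj G i k) (adj G k j)) ⟩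
      ∑[ k < n ] ι (adj G i k ∧ adj G k j)  ≤⟨ sum-ι≤1 _ (common-neighbour-unique c4-free i≢j) ⟩
      1ℤ                                    ≡⟨ cong (λ s → 1ℤ + s) (*-zeroˡ (deg i - 1ℤ)) ⟨
      1ℤ + 0ℤ * (deg i - 1ℤ)                ∎
      where open ≤-Reasoning

    -- `orient` splits the degree sum into `up` and `down`; exchanging the summations and using
    -- symmetry of `adj` turns the second into the first.
    handshake : sum deg ≡ + 2 * + edgeCount G
    handshake = begin
      ∑[ i < n ] ∑[ j < n ] (a i j * 1ℤ)
        ≡⟨ sum-cong-≗ (λ i → sum-cong-≗ (λ j → trans (*-identityʳ (a i j))
             (≡-sym (orient (toℕ i) (toℕ j) (adj G i j) (diagonal i j))))) ⟩
      ∑[ i < n ] ∑[ j < n ] (up i j + down i j)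
        ≡⟨ sum-cong-≗ (λ i → ∑-distrib-+ (up i) (down i)) ⟩
      ∑[ i < n ] (sum (up i) + sum (down i))
        ≡⟨ ∑-distrib-+ (λ i → sum (up i)) (λ i → sum (down i)) ⟩
      ∑[ i < n ] sum (up i) + ∑[ i < n ] ∑[ j < n ] down i j
        ≡⟨ cong (λ s → ∑[ i < n ] sum (up i) + s) (trans (∑-comm down)
             (sum-cong-≗ (λ j → sum-cong-≗ (λ i → cong (λ b → ι ((toℕ j <ᵇ toℕ i) ∧ b)) (sym G i j))))) ⟩
      ∑[ i < n ] sum (up i) + ∑[ i < n ] sum (up i)
        ≡⟨ cong (λ s → s + s) edges-up ⟨
      + edgeCount G + + edgeCount G
        ≡⟨ double (+ edgeCount G) ⟨
      + 2 * + edgeCount G ∎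
      where
      open ≡-Reasoning
      up down : Fin n → Fin n → ℤ
      up   i j = ι ((toℕ i <ᵇ toℕ j) ∧ adj G i j)
      down i j = ι ((toℕ j <ᵇ toℕ i) ∧ adj G i j)
      edges-up : + edgeCount G ≡ ∑[ i < n ] sum (up i)
      edges-up = trans (sum-allFin (λ i → ListAction.sum (List.map (edge i) (allFin n))))
                       (sum-cong-≗ (λ i → sum-allFin (edge i)))
        where
        edge : Fin n → Fin n → ℕ
        edge i j = if (toℕ i <ᵇ toℕ j) ∧ adj G i j then 1 else 0
      diagonal : ∀ i j → toℕ i ≡ toℕ j → adj G i j ≡ false
      diagonal i j i≡j = subst (λ k → adj G i k ≡ false) (toℕ-injective i≡j) (loopless G i)
      double : ∀ e → + 2 * e ≡ e + e
      double = solve-∀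

  -- The bound in natural numbers.

  -- As `r ≤ q`, the order is at most `(q + 1)²`, which `q < Q` would keep below `Q² + 1`.
  large-order : ∀ Q q r → r ℕ.≤ q → suc (Q ℕ.* Q) ℕ.≤ q ℕ.* q ℕ.+ q ℕ.+ 1 ℕ.+ r → Q ℕ.≤ q
  large-order Q q r r≤q Q²<n = ℕ.≮⇒≥ λ q<Q → ℕ.<-irrefl refl (begin-strict
    Q ℕ.* Q                          <⟨ Q²<n ⟩
    q ℕ.* q ℕ.+ q ℕ.+ 1 ℕ.+ r        ≤⟨ ℕ.+-monoʳ-≤ (q ℕ.* q ℕ.+ q ℕ.+ 1) r≤q ⟩
    q ℕ.* q ℕ.+ q ℕ.+ 1 ℕ.+ q        ≡⟨ square q ⟩
    suc q ℕ.* suc q                  ≤⟨ ℕ.*-mono-≤ q<Q q<Q ⟩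
    Q ℕ.* Q                          ∎)
    where
    open ℕ.≤-Reasoning
    square : ∀ q → q ℕ.* q ℕ.+ q ℕ.+ 1 ℕ.+ q ≡ suc q ℕ.* suc q
    square = ℕRing.solve-∀

  -- 1600 (1600³ + 1600 + 1)
  q₀ : ℕ
  q₀ = 6553602561600

  -- The factor 20 clears both `1/2` and `0.3`. In a counterexample the first branch of the maximum
  -- makes the total excess positive, and the second gives the lower bound on it that
  -- `no-large-excess` asks for.
  edge-bound : ∀ q r → q₀ ℕ.≤ q → 5 ℕ.* r ℕ.≤ 3 ℕ.* q →
    (G : SimpleGraph (q ℕ.* q ℕ.+ q ℕ.+ 1 ℕ.+ r)) → C4Free G →
    20 ℕ.* edgeCount G
      ℕ.≤ (10 ℕ.* (q ℕ.* q ℕ.+ q ℕ.+ 1) ℕ.+ ((10 ℕ.* r) ℕ.⊔ (20 ℕ.* r ℕ.∸ 3 ℕ.* q))) ℕ.* (q ℕ.+ 1)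
  edge-bound q r Q≤q 5r≤3q G c4-free = ℕ.≮⇒≥ refute
    where
    n M : ℕ
    n = q ℕ.* q ℕ.+ q ℕ.+ 1 ℕ.+ r
    M = (10 ℕ.* r) ℕ.⊔ (20 ℕ.* r ℕ.∸ 3 ℕ.* q)

    n≡ : + n ≡ + q * + q + + q + 1ℤ + + r
    n≡ = cong (λ s → s + + q + 1ℤ + + r) (pos-* q q)

    open WeightedGraph (a G) (a-sym G) (0≤a G) using (deg; x; no-large-excess)

    X : ℤ
    X = sum (x (codeg≤ G c4-free) (+ q) (+ r) n≡)

    X≡ : X ≡ + 2 * + edgeCount G - (+ q + 1ℤ) * (+ q * + q + + q + 1ℤ + + r)
    X≡ = begin
      X
        ≡⟨ sum-cong-≗ (λ i → split (deg i) (+ q)) ⟩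
      ∑[ i < n ] (1ℤ * deg i + (- (+ q + 1ℤ)) * 1ℤ)
        ≡⟨ sum-linear 1ℤ (- (+ q + 1ℤ)) deg (λ _ → 1ℤ) ⟩
      1ℤ * sum deg + (- (+ q + 1ℤ)) * ∑[ i < n ] 1ℤ
        ≡⟨ cong₂ (λ s c → 1ℤ * s + (- (+ q + 1ℤ)) * c) (handshake G) (trans (sum-const n) (cong (_* 1ℤ) n≡)) ⟩
      1ℤ * (+ 2 * + edgeCount G) + (- (+ q + 1ℤ)) * ((+ q * + q + + q + 1ℤ + + r) * 1ℤ)
        ≡⟨ collect (+ edgeCount G) (+ q) (+ q * + q + + q + 1ℤ + + r) ⟩
      + 2 * + edgeCount G - (+ q + 1ℤ) * (+ q * + q + + q + 1ℤ + + r) ∎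
      where
      open ≡-Reasoning
      split : ∀ d q → d - (q + 1ℤ) ≡ 1ℤ * d + (- (q + 1ℤ)) * 1ℤ
      split = solve-∀
      collect : ∀ e q n → 1ℤ * (+ 2 * e) + (- (q + 1ℤ)) * (n * 1ℤ) ≡ + 2 * e - (q + 1ℤ) * n
      collect = solve-∀

    10r≤M : + 10 * + r ≤ + M
    10r≤M = subst (_≤ + M) (pos-* 10 r) (+≤+ (ℕ.m≤m⊔n (10 ℕ.* r) _))

    -- Moving `3 q` across makes the truncation of `∸` harmless.
    20r≤3q+M : + 20 * + r ≤ + 3 * + q + + M
    20r≤3q+M = subst₂ (λ u v → u ≤ v + + M) (pos-* 20 r) (pos-* 3 q)
      (+≤+ (ℕ.≤-trans (ℕ.m≤n+m∸n (20 ℕ.* r) (3 ℕ.* q))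
        (ℕ.+-monoʳ-≤ (3 ℕ.* q) (ℕ.m≤n⊔m (10 ℕ.* r) (20 ℕ.* r ℕ.∸ 3 ℕ.* q)))))

    0≤m : 0ℤ ≤ + q + 1ℤ
    0≤m = 0≤+ q ⊕ 0≤+ 1

    bound : ℤ
    bound = (+ 10 * (+ q * + q + + q + 1ℤ) + + M) * (+ q + 1ℤ)

    bound≡ : + ((10 ℕ.* (q ℕ.* q ℕ.+ q ℕ.+ 1) ℕ.+ M) ℕ.* (q ℕ.+ 1)) ≡ bound
    bound≡ = trans (pos-* (10 ℕ.* (q ℕ.* q ℕ.+ q ℕ.+ 1) ℕ.+ M) (q ℕ.+ 1)) (cong (λ s → (s + + M) * (+ q + 1ℤ))
      (trans (pos-* 10 (q ℕ.* q ℕ.+ q ℕ.+ 1)) (cong (λ s → + 10 * (s + + q + 1ℤ)) (pos-* q q))))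

    refute : (10 ℕ.* (q ℕ.* q ℕ.+ q ℕ.+ 1) ℕ.+ M) ℕ.* (q ℕ.+ 1) ℕ.< 20 ℕ.* edgeCount G → ⊥
    -- At `L = 1600` the threshold `1600 (L³ + L + 1)` evaluates to `q₀`.
    refute many = no-large-excess (codeg≤ G c4-free) (+ q) (+ r) n≡ (+ 1600) ≤-refl (+≤+ Q≤q) (0≤+ r)
      (subst₂ _≤_ (pos-* 5 r) (pos-* 3 q) (+≤+ 5r≤3q)) (<⇒≤ 0<X) 0<X X≥
      where
      excessive : 1ℤ + bound ≤ + 20 * + edgeCount G
      excessive = i<j⇒suc[i]≤j (subst₂ _<_ bound≡ (pos-* 20 (edgeCount G)) (+<+ many))
      -- `10 X = 20 e - 10 m n` is at least `1 + (M - 10 r) m`, with `m = q + 1`; the 1 comes from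
      -- the strict inequality in `many`.
      1≤10X : 1ℤ ≤ + 10 * X
      1≤10X = subst (λ X → 1ℤ ≤ + 10 * X) (≡-sym X≡)
        (≤-by (gap excessive ⊕ gap 10r≤M ⊗ 0≤m) (certificate (+ edgeCount G) (+ q) (+ r) (+ M)))
        where
        certificate : ∀ e q r M → + 10 * (+ 2 * e - (q + 1ℤ) * (q * q + q + 1ℤ + r)) - 1ℤ
          ≡ (+ 20 * e - (1ℤ + (+ 10 * (q * q + q + 1ℤ) + M) * (q + 1ℤ))) + (M - + 10 * r) * (q + 1ℤ)
        certificate = solve-∀
      0<X : 0ℤ < X
      0<X = *-cancelˡ-<-nonNeg {i = 0ℤ} {j = X} (+ 10) (<-≤-trans (+<+ (s≤s z≤n)) 1≤10X)
      X≥ : (+ 10 * + r - + 3 * + q) * (+ q + 1ℤ) ≤ + 10 * X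
      X≥ = subst (λ X → (+ 10 * + r - + 3 * + q) * (+ q + 1ℤ) ≤ + 10 * X) (≡-sym X≡)
        (≤-by (gap excessive ⊕ 0≤+ 1 ⊕ gap 20r≤3q+M ⊗ 0≤m) (certificate (+ edgeCount G) (+ q) (+ r) (+ M)))
        where
        certificate : ∀ e q r M →
          + 10 * (+ 2 * e - (q + 1ℤ) * (q * q + q + 1ℤ + r)) - (+ 10 * r - + 3 * q) * (q + 1ℤ)
          ≡ (+ 20 * e - (1ℤ + (+ 10 * (q * q + q + 1ℤ) + M) * (q + 1ℤ))) + 1ℤ
            + (+ 3 * q + M - + 20 * r) * (q + 1ℤ)
        certificate = solve-∀

  r≤q : ∀ q r → 5 ℕ.* r ℕ.≤ 3 ℕ.* q → r ℕ.≤ q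
  r≤q q r 5r≤3q = ℕ.*-cancelˡ-≤ 5 (ℕ.≤-trans 5r≤3q (ℕ.*-monoˡ-≤ q (ℕ.m≤m+n 3 2)))

open import Data.Nat using (ℕ; suc; _+_; _*_; _∸_; _≤_; _⊔_)
open import Data.Product using (∃-syntax; _,_)
open Counting using (q₀; r≤q; large-order; edge-bound)

theorem1p5 : ∃[ N₀ ] ∀ (q r : ℕ) → 1 ≤ q → 1 ≤ r → 5 * r ≤ 3 * q
    → N₀ ≤ q * q + q + 1 + r
    → ∀ (G : SimpleGraph (q * q + q + 1 + r)) → C4Free G
    → 20 * edgeCount G ≤ (10 * (q * q + q + 1) + ((10 * r) ⊔ (20 * r ∸ 3 * q))) * (q + 1)
-- Under `r ≤ q` alone, `q = q₀ - 1` still allows order `q₀²`, hence the successor.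
theorem1p5 = suc (q₀ * q₀) , λ q r _ _ 5r≤3q N₀≤n →
  edge-bound q r (large-order q₀ q r (r≤q q r 5r≤3q) N₀≤n) 5r≤3q
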